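{- Let $G$ and $H$ be graphs. If both $G$ and $H$ are R-cores and $G\backsim_w H$ (that is, they lie in the same equivalence class of weak relational equivalence), then $G$ and $H$ are isomorphic.
   Context: Graphs are finite and undirected, with loops allowed: $G=(V_G,E_G)$ with $E_G\subseteq V_G\times V_G$ symmetric. A relation $R\subseteq X\times Y$ has full domain if every $x\in X$ is related to some $p\in Y$, and full image if every $p\in Y$ is related to by some $x\in X$. For a graph $G$, a finite set $B$ and a relation $R\subseteq V_G\times B$ with full image, $G\ast R$ is the graph with vertex set $B$ and edge set $\{(u,v)\in B\times B : \text{there is } (x,y)\in E_G \text{ with } (x,u),(y,v)\in R\}$. The equation $G\ast R=H$ means that $R\subseteq V_G\times V_H$ has full image and $G\ast R$ equals $H$ as a graph. Graphs $G,H$ are weakly relationally equivalent, $G\backsim_w H$, if there are relations $R\subseteq V_G\times V_H$ and $S\subseteq V_H\times V_G$, both with full domain, such that $G\ast R=H$ and $H\ast S=G$. This is an equivalence relation on graphs. A graph is an R-core if it has the smallest number of vertices among all graphs in its $\backsim_w$-equivalence class. -}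

module Defs where

open import Data.Fin.Base using (Fin)
open import Data.Fin.Properties using (any?)
open import Data.Nat.Base using (ℕ; _≤_)
open import Data.Product.Base using (Σ-syntax; ∃-syntax; _×_; _,_)
open import Function.Bundles using (_↔_; Inverse) renaming (_⇔_ to _iff_)
open import Level using (0ℓ)
open import Relation.Binary.Core using (Rel; REL; _⇔_)
open import Relation.Binary.Definitions using (Symmetric; Decidable)
open import Relation.Binary.PropositionalEquality.Core using (subst; sym)
open import Relation.Nullary.Decidable using (Dec; map′; _×-dec_)
import Relation.Unary as Unary

record FiniteSet : Set₁ where
  field
    Element     : Set
    size        : ℕ
    enumeration : Element ↔ Fin size

open FiniteSet public

∃? : (X : FiniteSet) {P : Unary.Pred (Element X) 0ℓ} →
     Unary.Decidable P → Dec (∃[ x ] P x)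
∃? X {P} P? = map′
  (λ (i , p) → from i , p)
  (λ (x , p) → to x , subst P (sym (strictlyInverseʳ x)) p)
  (any? (λ i → P? (from i)))
  where open Inverse (enumeration X)

-- Classically, every subset of a product of finite sets is decidable, so the
-- decidability fields here and in Graph carry no mathematical restriction.
record Relation (X Y : FiniteSet) : Set₁ where
  field
    Related  : REL (Element X) (Element Y) 0ℓ
    related? : Decidable Related

open Relation public

FullDomain : {X Y : FiniteSet} → Relation X Y → Set
FullDomain R = ∀ x → ∃[ p ] Related R x p

FullImage : {X Y : FiniteSet} → Relation X Y → Set
FullImage R = ∀ p → ∃[ x ] Related R x p

record Graph : Set₁ where
  field
    V        : FiniteSet
    Edge     : Rel (Element V) 0ℓ
    edge?    : Decidable Edge
    edge-sym : Symmetric Edge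

open Graph public

order : Graph → ℕ
order G = size (V G)

-- Defined for every R; full image is demanded separately, in Equation.
infixl 7 _∗_
_∗_ : (G : Graph) {B : FiniteSet} → Relation (V G) B → Graph
V        (_∗_ G {B} R) = B
Edge     (G ∗ R) u v =
  ∃[ x ] ∃[ y ] (Edge G x y × Related R x u × Related R y v)
edge?    (G ∗ R) u v =
  ∃? (V G) λ x → ∃? (V G) λ y →
    edge? G x y ×-dec related? R x u ×-dec related? R y v
edge-sym (G ∗ R) (x , y , xy , xu , yv) = y , x , edge-sym G xy , yv , xu

-- The equation G ∗ R = H. Both graphs have vertex set V H by typing, so their
-- equality amounts to having the same edges.
Equation : (G H : Graph) → Relation (V G) (V H) → Set
Equation G H R = FullImage R × (Edge (G ∗ R) ⇔ Edge H)

infix 4 _∽w_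
_∽w_ : Graph → Graph → Set₁
G ∽w H =
  Σ[ R ∈ Relation (V G) (V H) ] Σ[ S ∈ Relation (V H) (V G) ]
    (FullDomain R × FullDomain S × Equation G H R × Equation H G S)

IsRCore : Graph → Set₁
IsRCore G = ∀ K → G ∽w K → order G ≤ order K

infix 4 _≅_
record _≅_ (G H : Graph) : Set where
  field
    bijection : Element (V G) ↔ Element (V H)
  open Inverse bijection using (to)
  field
    edges : ∀ x y → Edge G x y iff Edge H (to x) (to y)

{-# OPTIONS --safe #-}

-- Let R relate V_G to V_H with G ∗ R = H. If A ⊆ V_G and B ⊆ V_H together meet
-- every pair of R, then R factors through the disjoint union A ⊎ B, which
-- carries a graph weakly equivalent to G; so an R-core G has at most ∣A∣ + ∣B∣
-- vertices. With A the complement of a set C and B the set of neighbours of C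
-- this is Hall's condition for R, and a matching of V_G into V_H inside R is an
-- injective homomorphism f : G → H. By symmetry there is an injective
-- homomorphism g : H → G. Injective self-maps of finite sets are recurrent, and
-- recurrence of f ∘ g makes f surjective, that of g ∘ f makes it reflect edges.
module Submission where

open import Defs

open import Data.Fin.Base using (Fin; zero; suc; toℕ; combine)
open import Data.Fin.Properties
  using (any?; _≟_; +↔⊎; pigeonhole; combine-injective)
open import Data.Fin.Subset
  using (Subset; inside; outside; _∈_; _∉_; _⊆_; _⊂_; _∪_; _∩_; _-_; ∁; ⁅_⁆; ∣_∣; Nonempty)
open import Data.Fin.Subset.Properties
open import Data.List.Base using ([]; _∷_; allFin)
open import Data.List.Membership.Propositional using () renaming (_∈_ to _∈ₗ_)
open import Data.List.Membership.Propositional.Properties using (∈-allFin)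
open import Data.List.Relation.Unary.Any using (here; there)
open import Data.Nat.Base using (ℕ; zero; suc; _+_; _*_; _∸_; _≤_; _<_; s≤s; s<s)
open import Data.Nat.GeneralisedArithmetic using (fold)
open import Data.Nat.Induction using (<-wellFounded)
import Data.Nat.Properties as ℕ
open import Data.Product.Base using (∃-syntax; _×_; _,_; proj₁; proj₂)
open import Data.Product.Properties using (,-injective)
open import Data.Sum.Base as Sum using (_⊎_; inj₁; inj₂)
open import Data.Vec.Base using ([]; _∷_; here; there; tabulate)
open import Data.Vec.Functional using (updateAt)
open import Data.Vec.Functional.Properties using (updateAt-updates; updateAt-minimal)
open import Data.Vec.Properties using (lookup∘tabulate; []=⇒lookup; lookup⇒[]=)
open import Function.Base using (_∘_; id)
open import Function.Bundles using (Injection; Inverse; mk↔ₛ′; mk⇔)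
open import Function.Definitions using (Injective)
open import Function.Properties.Inverse using (↔-sym; ↔⇒↣)
open import Induction.WellFounded using (Acc; acc)
open import Level using (0ℓ)
open import Relation.Binary.Core using (_⇔_)
open import Relation.Binary.Definitions using (DecidableEquality)
open import Relation.Binary.PropositionalEquality
  using (_≡_; _≢_; refl; sym; trans; cong; cong₂; subst; subst₂)
open import Relation.Nullary.Decidable
  using (Dec; yes; no; does; ¬?; _×-dec_; decidable-stable; dec-true; via-injection)
open import Relation.Nullary.Negation using (¬_; contradiction)
open import Relation.Unary using (Pred; Decidable)

private variable
  m n : ℕ

-- Recurrence of injective self-maps

module _ {A : Set} {σ : A → A} (σ-injective : Injective _≡_ _≡_ σ) where

  -- Injectivity cancels the `i` applications common to both sides; `i < j` leaves at least one, so
  -- the period is positive.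
  fold-collision⇒periodic : ∀ {x i j} → i < j → fold x σ i ≡ fold x σ j →
                            ∃[ k ] x ≡ fold x σ (suc k)
  fold-collision⇒periodic {i = zero}  {suc j} _         eq = j , eq
  fold-collision⇒periodic {i = suc i} {suc j} (s<s i<j) eq =
    fold-collision⇒periodic i<j (σ-injective eq)

  -- Finiteness of `A` enters only through `code`. Two of the first `n + 1` iterates collide, so `x`
  -- lies on a cycle, and `P` is carried forward from `σ x` around the cycle back to `x`.
  recurrent : {code : A → Fin n} → Injective _≡_ _≡_ code →
              (P : Pred A 0ℓ) → (∀ x → P x → P (σ x)) → ∀ x → P (σ x) → P x
  recurrent {n = n} {code} code-injective P closed x Pσx
    with i , j , i<j , eq ← pigeonhole (ℕ.n<1+n n) (λ i → code (fold x σ (toℕ i)))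
    with k , x≡ ← fold-collision⇒periodic i<j (code-injective eq)
    = subst P (sym x≡) (iterates k)
    where
    iterates : ∀ k → P (fold x σ (suc k))
    iterates zero    = Pσx
    iterates (suc k) = closed _ (iterates k)

-- Finite subsets

module _ {P : Pred (Fin n) 0ℓ} (P? : Decidable P) where

  comprehension : Subset n
  comprehension = tabulate (does ∘ P?)

  ∈-comprehension⁺ : ∀ {x} → P x → x ∈ comprehension
  ∈-comprehension⁺ {x} Px =
    lookup⇒[]= x _ (trans (lookup∘tabulate _ x) (dec-true (P? x) Px))

  ∈-comprehension⁻ : ∀ {x} → x ∈ comprehension → P x
  ∈-comprehension⁻ {x} x∈
    with P? x | trans (sym (lookup∘tabulate (does ∘ P?) x)) ([]=⇒lookup x∈)
  ... | yes Px | _ = Px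

∣p∪q∣+∣p∩q∣≡∣p∣+∣q∣ : (p q : Subset n) → ∣ p ∪ q ∣ + ∣ p ∩ q ∣ ≡ ∣ p ∣ + ∣ q ∣
∣p∪q∣+∣p∩q∣≡∣p∣+∣q∣ []            []            = refl
∣p∪q∣+∣p∩q∣≡∣p∣+∣q∣ (outside ∷ p) (outside ∷ q) = ∣p∪q∣+∣p∩q∣≡∣p∣+∣q∣ p q
∣p∪q∣+∣p∩q∣≡∣p∣+∣q∣ (inside  ∷ p) (outside ∷ q) = cong suc (∣p∪q∣+∣p∩q∣≡∣p∣+∣q∣ p q)
∣p∪q∣+∣p∩q∣≡∣p∣+∣q∣ (outside ∷ p) (inside  ∷ q) =
  trans (cong suc (∣p∪q∣+∣p∩q∣≡∣p∣+∣q∣ p q)) (sym (ℕ.+-suc _ _))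
∣p∪q∣+∣p∩q∣≡∣p∣+∣q∣ (inside  ∷ p) (inside  ∷ q) = cong suc
  (trans (ℕ.+-suc _ _)
    (trans (cong suc (∣p∪q∣+∣p∩q∣≡∣p∣+∣q∣ p q)) (sym (ℕ.+-suc _ _))))

∣p∣≤1+∣p-x∣ : (p : Subset n) (x : Fin n) → ∣ p ∣ ≤ suc ∣ p - x ∣
∣p∣≤1+∣p-x∣ p x = begin
  ∣ p ∣                                         ≤⟨ p⊆q⇒∣p∣≤∣q∣ p⊆ ⟩
  ∣ (p - x) ∪ ⁅ x ⁆ ∣                           ≤⟨ ℕ.m≤m+n _ _ ⟩
  ∣ (p - x) ∪ ⁅ x ⁆ ∣ + ∣ (p - x) ∩ ⁅ x ⁆ ∣     ≡⟨ ∣p∪q∣+∣p∩q∣≡∣p∣+∣q∣ (p - x) ⁅ x ⁆ ⟩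
  ∣ p - x ∣ + ∣ ⁅ x ⁆ ∣                         ≡⟨ cong (∣ p - x ∣ +_) (∣⁅x⁆∣≡1 x) ⟩
  ∣ p - x ∣ + 1                                 ≡⟨ ℕ.+-comm _ 1 ⟩
  suc ∣ p - x ∣                                 ∎
  where
  open ℕ.≤-Reasoning
  p⊆ : p ⊆ (p - x) ∪ ⁅ x ⁆
  p⊆ {y} y∈p with y ≟ x
  ... | yes refl = x∈p∪q⁺ (inj₂ (x∈⁅x⁆ x))
  ... | no  y≢x  = x∈p∪q⁺ (inj₁ (x∈p∧x≢y⇒x∈p-y y∈p y≢x))

x∉p-x : ∀ {x} (p : Subset n) → x ∉ p - x
x∉p-x {x = suc x} (_ ∷ p) (there x∈) = x∉p-x p x∈

1≤∣p∣⇒nonempty : (p : Subset n) → 1 ≤ ∣ p ∣ → Nonempty p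
1≤∣p∣⇒nonempty {n} p 1≤∣p∣ = decidable-stable (nonempty? p) λ empty →
  ℕ.<⇒≢ 1≤∣p∣ (sym (trans (cong ∣_∣ (Empty-unique empty)) (∣⊥∣≡0 n)))

element : (p : Subset n) → Fin ∣ p ∣ → Fin n
element (inside  ∷ p) zero    = zero
element (inside  ∷ p) (suc i) = suc (element p i)
element (outside ∷ p) i       = suc (element p i)

element-surjective : ∀ {p : Subset n} {x} → x ∈ p → ∃[ i ] element p i ≡ x
element-surjective here = zero , refl
element-surjective {p = inside ∷ p} (there x∈p) with i , eq ← element-surjective x∈p =
  suc i , cong suc eq
element-surjective {p = outside ∷ p} (there x∈p) with i , eq ← element-surjective x∈p =
  i , cong suc eq

-- Hall's theorem

module _ (r : Fin m → Subset n) (A : Subset m) where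

  neighbour? : Decidable λ y → ∃[ x ] (x ∈ A × y ∈ r x)
  neighbour? y = any? λ x → (x ∈? A) ×-dec (y ∈? r x)

  neighbours : Subset n
  neighbours = comprehension neighbour?

  ∈-neighbours⁺ : ∀ {x y} → x ∈ A → y ∈ r x → y ∈ neighbours
  ∈-neighbours⁺ x∈A y∈rx = ∈-comprehension⁺ neighbour? (_ , x∈A , y∈rx)

  ∈-neighbours⁻ : ∀ {y} → y ∈ neighbours → ∃[ x ] (x ∈ A × y ∈ r x)
  ∈-neighbours⁻ = ∈-comprehension⁻ neighbour?

Hall : (Fin m → Subset n) → Set
Hall r = ∀ A → ∣ A ∣ ≤ ∣ neighbours r A ∣

AtMostOne : Subset n → Set
AtMostOne p = ∀ {y z} → y ∈ p → z ∈ p → y ≡ z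

module _ (r : Fin m → Subset n) where

  -- Subsets of a finite set can be searched exhaustively; a failure yields the violating set that
  -- the exchange argument works with.
  hall? : Hall r ⊎ ∃[ A ] ∣ neighbours r A ∣ < ∣ A ∣
  hall? with anySubset? (λ A → ∣ neighbours r A ∣ ℕ.<? ∣ A ∣)
  ... | yes violated = inj₂ violated
  ... | no ¬violated = inj₁ λ A → ℕ.≮⇒≥ λ lt → ¬violated (A , lt)

  remove : Fin m → Fin n → Fin m → Subset n
  remove x y = updateAt r x (_- y)

  remove-⊆ : ∀ x y x′ → remove x y x′ ⊆ r x′
  remove-⊆ x y x′ z∈ with x′ ≟ x
  ... | yes refl = p─q⊆p _ _ (subst (_ ∈_) (updateAt-updates x r) z∈)
  ... | no x′≢x  = subst (_ ∈_) (updateAt-minimal x′ x r x′≢x) z∈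

  ∈-remove-≢ˡ : ∀ {x y x′ z} → x′ ≢ x → z ∈ r x′ → z ∈ remove x y x′
  ∈-remove-≢ˡ x′≢x = subst (_ ∈_) (sym (updateAt-minimal _ _ r x′≢x))

  ∈-remove-≢ʳ : ∀ {x y z} → z ≢ y → z ∈ r x → z ∈ remove x y x
  ∈-remove-≢ʳ {x} z≢y z∈rx =
    subst (_ ∈_) (sym (updateAt-updates x r)) (x∈p∧x≢y⇒x∈p-y z∈rx z≢y)

  ∣remove∣< : ∀ {x y} → y ∈ r x → ∣ remove x y x ∣ < ∣ r x ∣
  ∣remove∣< {x} y∈rx =
    subst (λ p → ∣ p ∣ < ∣ r x ∣) (sym (updateAt-updates x r)) (x∈p⇒∣p-x∣<∣p∣ y∈rx)

  module _ (hall : Hall r) {x : Fin m} where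

    -- Only row `x` shrinks, so a set avoiding `x` keeps all its neighbours and still satisfies the
    -- bound given by `hall`.
    violation-∋ : ∀ {y A} → ∣ neighbours (remove x y) A ∣ < ∣ A ∣ → x ∈ A
    violation-∋ {y} {A} lt = decidable-stable (x ∈? A) λ x∉A →
      ℕ.<⇒≱ lt (ℕ.≤-trans (hall A) (p⊆q⇒∣p∣≤∣q∣ (unaffected x∉A)))
      where
      unaffected : x ∉ A → neighbours r A ⊆ neighbours (remove x y) A
      unaffected x∉A z∈ with x′ , x′∈A , z∈rx′ ← ∈-neighbours⁻ r A z∈ =
        ∈-neighbours⁺ (remove x y) A x′∈A (∈-remove-≢ˡ (λ { refl → x∉A x′∈A }) z∈rx′)

    -- Rado's argument: by submodularity of the neighbourhood size, violations A
    -- and B for the two removals would make A ∪ B or (A ∩ B) - x violate Hall's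
    -- condition for r itself.
    ¬both-violated : ∀ {y z A B} → y ≢ z →
      ∣ neighbours (remove x y) A ∣ < ∣ A ∣ →
      ¬ (∣ neighbours (remove x z) B ∣ < ∣ B ∣)
    ¬both-violated {y} {z} {A} {B} y≢z A< B< = ℕ.1+n≰n (begin
      -- The two strict violations contribute 2, whereas dropping `x` from `A ∩ B` costs only 1;
      -- this gap is the contradiction.
      suc (suc (∣ N₁ ∣ + ∣ N₂ ∣))                   ≡⟨ cong suc (ℕ.+-suc _ _) ⟨
      suc ∣ N₁ ∣ + suc ∣ N₂ ∣                       ≤⟨ ℕ.+-mono-≤ A< B< ⟩
      ∣ A ∣ + ∣ B ∣                                 ≡⟨ ∣p∪q∣+∣p∩q∣≡∣p∣+∣q∣ A B ⟨
      ∣ A ∪ B ∣ + ∣ A ∩ B ∣                         ≤⟨ ℕ.+-mono-≤ ∪≤ ∩≤ ⟩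
      ∣ N₁ ∪ N₂ ∣ + suc ∣ N₁ ∩ N₂ ∣                 ≡⟨ ℕ.+-suc _ _ ⟩
      suc (∣ N₁ ∪ N₂ ∣ + ∣ N₁ ∩ N₂ ∣)               ≡⟨ cong suc (∣p∪q∣+∣p∩q∣≡∣p∣+∣q∣ N₁ N₂) ⟩
      suc (∣ N₁ ∣ + ∣ N₂ ∣)                         ∎)
      where
      open ℕ.≤-Reasoning
      N₁ = neighbours (remove x y) A
      N₂ = neighbours (remove x z) B

      N₁⁺ : ∀ {u w} → u ∈ A → w ∈ remove x y u → w ∈ N₁
      N₁⁺ = ∈-neighbours⁺ (remove x y) A

      N₂⁺ : ∀ {u w} → u ∈ B → w ∈ remove x z u → w ∈ N₂
      N₂⁺ = ∈-neighbours⁺ (remove x z) B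

      -- Each neighbour of x survives one of the two removals, and x ∈ A ∩ B.
      N∪⊆ : neighbours r (A ∪ B) ⊆ N₁ ∪ N₂
      N∪⊆ {w} w∈ with u , u∈A∪B , w∈ru ← ∈-neighbours⁻ r _ w∈ with u ≟ x
      ... | no u≢x = x∈p∪q⁺ (Sum.map (λ u∈A → N₁⁺ u∈A (∈-remove-≢ˡ u≢x w∈ru))
                                     (λ u∈B → N₂⁺ u∈B (∈-remove-≢ˡ u≢x w∈ru))
                                     (x∈p∪q⁻ A B u∈A∪B))
      ... | yes refl with w ≟ y
      ...   | no w≢y   = x∈p∪q⁺ (inj₁ (N₁⁺ (violation-∋ A<) (∈-remove-≢ʳ w≢y w∈ru)))
      ...   | yes refl = x∈p∪q⁺ (inj₂ (N₂⁺ (violation-∋ B<) (∈-remove-≢ʳ y≢z w∈ru)))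

      -- Without `x`, only rows untouched by both removals remain; row `x` itself could reach `y` or
      -- `z`, which may be missing from `N₁` or `N₂`.
      N∩⊆ : neighbours r ((A ∩ B) - x) ⊆ N₁ ∩ N₂
      N∩⊆ w∈ with u , u∈ , w∈ru ← ∈-neighbours⁻ r _ w∈
             with u∈A , u∈B ← x∈p∩q⁻ A B (p─q⊆p (A ∩ B) ⁅ x ⁆ u∈)
        = x∈p∩q⁺ (N₁⁺ u∈A (∈-remove-≢ˡ u≢x w∈ru) , N₂⁺ u∈B (∈-remove-≢ˡ u≢x w∈ru))
        where
        u≢x : u ≢ x
        u≢x refl = x∉p-x (A ∩ B) u∈

      ∪≤ : ∣ A ∪ B ∣ ≤ ∣ N₁ ∪ N₂ ∣
      ∪≤ = ℕ.≤-trans (hall (A ∪ B)) (p⊆q⇒∣p∣≤∣q∣ N∪⊆)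

      ∩≤ : ∣ A ∩ B ∣ ≤ suc ∣ N₁ ∩ N₂ ∣
      ∩≤ = ℕ.≤-trans (∣p∣≤1+∣p-x∣ (A ∩ B) x)
             (s≤s (ℕ.≤-trans (hall ((A ∩ B) - x)) (p⊆q⇒∣p∣≤∣q∣ N∩⊆)))

-- `Thin` marks the rows already cut down; it is a parameter so that the same notion serves for one
-- row and for a list of rows.
Refinement : (r : Fin m → Subset n) → (Fin m → Set) → Set
Refinement {m} {n} r Thin =
  ∃[ r′ ] (Hall {m} {n} r′ × (∀ x → r′ x ⊆ r x) × (∀ {x} → Thin x → AtMostOne (r′ x)))

-- While row `x` holds two distinct elements, Rado's argument lets one of them be removed without
-- losing Hall's condition; the size of the row decreases each time.
thin : (r : Fin m → Subset n) → Hall r → ∀ x → Refinement r (x ≡_)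
thin {m} {n} r hall x = go r hall (<-wellFounded _)
  where
  distinct? : (p : Subset n) → Dec (∃[ y ] ∃[ z ] (y ∈ p × z ∈ p × y ≢ z))
  distinct? p = any? λ y → any? λ z → (y ∈? p) ×-dec (z ∈? p) ×-dec ¬? (y ≟ z)

  go : ∀ r → Hall r → Acc _<_ ∣ r x ∣ → Refinement r (x ≡_)
  -- The recursive call is shared by the cases in which `y` or `z` is the removable element.
  remove-go : ∀ r {y} → Acc _<_ ∣ r x ∣ → y ∈ r x → Hall (remove r x y) → Refinement r (x ≡_)

  go r hall ac with distinct? (r x)
  ... | no ¬distinct = r , hall , (λ _ → id) , λ { refl y∈ z∈ →
          decidable-stable (_ ≟ _) λ y≢z → ¬distinct (_ , _ , y∈ , z∈ , y≢z) }
  ... | yes (y , z , y∈ , z∈ , y≢z) with hall? (remove r x y) | hall? (remove r x z)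
  ...   | inj₁ hall′   | _            = remove-go r ac y∈ hall′
  ...   | inj₂ _       | inj₁ hall′   = remove-go r ac z∈ hall′
  ...   | inj₂ (_ , A<) | inj₂ (_ , B<) = contradiction B< (¬both-violated r hall y≢z A<)

  remove-go r (acc rs) y∈ hall′
    with r″ , hall″ , r″⊆ , thin″ ← go (remove r x _) hall′ (rs (∣remove∣< r y∈))
    = r″ , hall″ , (λ x′ → remove-⊆ r x _ x′ ∘ r″⊆ x′) , thin″

-- Rows are treated one after another: later refinements only shrink rows, so a row once thin stays
-- thin.
thinAll : (r : Fin m → Subset n) → Hall r → ∀ xs → Refinement r (_∈ₗ xs)
thinAll r hall []       = r , hall , (λ _ → id) , λ ()
thinAll r hall (x ∷ xs)
  with r′ , hall′ , r′⊆ , thin′ ← thin r hall x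
  with r″ , hall″ , r″⊆ , thin″ ← thinAll r′ hall′ xs
  = r″ , hall″ , (λ x′ → r′⊆ x′ ∘ r″⊆ x′) , λ
    { (here refl)  y∈ z∈ → thin′ refl (r″⊆ x y∈) (r″⊆ x z∈)
    ; (there x∈xs) → thin″ x∈xs }

-- This is Hall's condition for the singleton of `x`.
hall⇒nonempty : {r : Fin m → Subset n} → Hall r → ∀ x → Nonempty (r x)
hall⇒nonempty {r = r} hall x
  with y , y∈ ← 1≤∣p∣⇒nonempty _ (ℕ.≤-trans (ℕ.≤-reflexive (sym (∣⁅x⁆∣≡1 x))) (hall ⁅ x ⁆))
  with x′ , x′∈ , y∈rx′ ← ∈-neighbours⁻ r _ y∈
  with refl ← x∈⁅y⁆⇒x≡y x x′∈
  = y , y∈rx′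

-- Two rows with the same sole representative would form a two-element set with at most one
-- neighbour.
unique-representatives-injective :
  {r : Fin m → Subset n} → Hall r →
  {f : Fin m → Fin n} → (∀ {x y} → y ∈ r x → y ≡ f x) → Injective _≡_ _≡_ f
unique-representatives-injective {r = r} hall {f} f-unique {x} {x′} fx≡fx′ =
  decidable-stable (x ≟ x′) λ x≢x′ → ℕ.1+n≰n (begin
  2                             ≡⟨ cong suc (∣⁅x⁆∣≡1 x) ⟨
  suc ∣ ⁅ x ⁆ ∣                 ≤⟨ p⊂q⇒∣p∣<∣q∣ (⊂pair x≢x′) ⟩
  ∣ pair ∣                      ≤⟨ hall pair ⟩
  ∣ neighbours r pair ∣         ≤⟨ p⊆q⇒∣p∣≤∣q∣ N⊆ ⟩
  ∣ ⁅ f x ⁆ ∣                   ≡⟨ ∣⁅x⁆∣≡1 (f x) ⟩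
  1                             ∎)
  where
  open ℕ.≤-Reasoning
  pair = ⁅ x ⁆ ∪ ⁅ x′ ⁆

  ⊂pair : x ≢ x′ → ⁅ x ⁆ ⊂ pair
  ⊂pair x≢x′ = p⊆p∪q ⁅ x′ ⁆ , x′ , q⊆p∪q ⁅ x ⁆ ⁅ x′ ⁆ (x∈⁅x⁆ x′) ,
               λ x′∈⁅x⁆ → x≢x′ (sym (x∈⁅y⁆⇒x≡y x x′∈⁅x⁆))

  N⊆ : neighbours r pair ⊆ ⁅ f x ⁆
  N⊆ y∈ with u , u∈ , y∈ru ← ∈-neighbours⁻ r _ y∈ with x∈p∪q⁻ ⁅ x ⁆ ⁅ x′ ⁆ u∈
  ... | inj₁ u∈⁅x⁆ with refl ← x∈⁅y⁆⇒x≡y x u∈⁅x⁆ with refl ← f-unique y∈ru = x∈⁅x⁆ (f x)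
  ... | inj₂ u∈⁅x′⁆ with refl ← x∈⁅y⁆⇒x≡y x′ u∈⁅x′⁆ with refl ← f-unique y∈ru =
    subst (λ v → f x′ ∈ ⁅ v ⁆) (sym fx≡fx′) (x∈⁅x⁆ (f x′))

-- Hall's marriage theorem: once all rows are thin, each is a singleton, and the refined family is
-- itself the matching.
matching : (r : Fin m → Subset n) → Hall r →
           ∃[ f ] (Injective _≡_ _≡_ f × (∀ x → f x ∈ r x))
matching {m} r hall with r′ , hall′ , r′⊆ , thin′ ← thinAll r hall (allFin m) =
  proj₁ ∘ nonempty ,
  unique-representatives-injective hall′ (λ {x} y∈ →
    thin′ (∈-allFin x) y∈ (proj₂ (nonempty x))) ,
  λ x → r′⊆ x (proj₂ (nonempty x))
  where
  nonempty = hall⇒nonempty hall′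

-- Factoring a relation between weakly equivalent graphs

module Enumeration (X : FiniteSet) where
  open Inverse (enumeration X) public
  open Injection (↔⇒↣ (enumeration X)) public
    using () renaming (injective to to-injective)
  open Injection (↔⇒↣ (↔-sym (enumeration X))) public
    using () renaming (injective to from-injective)

element-≟ : (X : FiniteSet) → DecidableEquality (Element X)
element-≟ X = via-injection (↔⇒↣ (enumeration X)) _≟_

compose : {X Y Z : FiniteSet} → Relation X Y → Relation Y Z → Relation X Z
Related  (compose P Q) x z = ∃[ y ] (Related P x y × Related Q y z)
related? (compose {Y = Y} P Q) x z = ∃? Y λ y → related? P x y ×-dec related? Q y z

InjectiveHom : Graph → Graph → Set
InjectiveHom G H =
  ∃[ f ] (Injective _≡_ _≡_ f × (∀ {x y} → Edge G x y → Edge H (f x) (f y)))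

module _ {G H : Graph} (G-core : IsRCore G)
  (R : Relation (V G) (V H)) (S : Relation (V H) (V G))
  (Rdom : FullDomain R) (Sdom : FullDomain S)
  (Rimg : FullImage R) (G∗R⇔H : Edge (G ∗ R) ⇔ Edge H)
  (Simg : FullImage S) (H∗S⇔G : Edge (H ∗ S) ⇔ Edge G)
  where

  -- The graph `G ∗ P` is weakly equivalent to `G`: the way there is `P`, and the way back is `Q`
  -- followed by `S`, since applying `P`, `Q` and `S` in turn amounts to applying `R` and then `S`.
  -- Minimality of the core then bounds its order by that of `G ∗ P`.
  core≤factor : {B : FiniteSet} (P : Relation (V G) B) (Q : Relation B (V H)) →
    FullDomain P → FullImage P → FullDomain Q → FullImage Q →
    Related (compose P Q) ⇔ Related R → order G ≤ size B
  core≤factor P Q Pdom Pimg Qdom Qimg (PQ⇒R , R⇒PQ) =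
    G-core (G ∗ P) (P , compose Q S , Pdom , QSdom , (Pimg , id , id) , (QSimg , QS⇒G , G⇒QS))
    where
    QSdom : FullDomain (compose Q S)
    QSdom b = let p , bp = Qdom b ; u , pu = Sdom p in u , p , bp , pu

    QSimg : FullImage (compose Q S)
    QSimg u = let p , pu = Simg u ; b , bp = Qimg p in b , p , bp , pu

    QS⇒G : ∀ {u v} → Edge (G ∗ P ∗ compose Q S) u v → Edge G u v
    QS⇒G (a , b , (x , y , xy , xa , yb) , (p , ap , pu) , (q , bq , qv)) =
      proj₁ H∗S⇔G (p , q ,
        proj₁ G∗R⇔H (x , y , xy , PQ⇒R (a , xa , ap) , PQ⇒R (b , yb , bq)) , pu , qv)

    G⇒QS : ∀ {u v} → Edge G u v → Edge (G ∗ P ∗ compose Q S) u v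
    G⇒QS uv =
      let p , q , pq , pu , qv = proj₂ H∗S⇔G uv
          x , y , xy , xp , yq = proj₂ G∗R⇔H pq
          a , xa , ap = R⇒PQ xp
          b , yb , bq = R⇒PQ yq
      in a , b , (x , y , xy , xa , yb) , (p , ap , pu) , (q , bq , qv)

  private
    module G = Enumeration (V G)
    module H = Enumeration (V H)

  -- A related pair passes through its first vertex if that lies in `A`, and through its second if
  -- that lies in `B`.
  core≤cover : (A : Subset (order G)) (B : Subset (order H)) →
    (∀ {x p} → Related R x p → G.to x ∈ A ⊎ H.to p ∈ B) → order G ≤ ∣ A ∣ + ∣ B ∣
  core≤cover A B cover =
    core≤factor P Q Pdom Pimg Qdom Qimg (PQ⇒R , R⇒PQ)
    where
    A⊎B : FiniteSet
    -- The field `size` is inferred from the enumeration as `∣ A ∣ + ∣ B ∣`.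
    A⊎B = record { Element = Fin ∣ A ∣ ⊎ Fin ∣ B ∣ ; enumeration = ↔-sym +↔⊎ }

    a : Fin ∣ A ∣ → Element (V G)
    a i = G.from (element A i)

    b : Fin ∣ B ∣ → Element (V H)
    b j = H.from (element B j)

    a-surjective : ∀ {x} → G.to x ∈ A → ∃[ i ] a i ≡ x
    a-surjective {x} x∈A = let i , eq = element-surjective x∈A in
      i , trans (cong G.from eq) (G.strictlyInverseʳ x)

    b-surjective : ∀ {p} → H.to p ∈ B → ∃[ j ] b j ≡ p
    b-surjective {p} p∈B = let j , eq = element-surjective p∈B in
      j , trans (cong H.from eq) (H.strictlyInverseʳ p)

    -- On the `A` half `P` is equality and `Q` is `R`; on the `B` half the roles are exchanged.
    -- Either way the composite stays inside `R`.
    P : Relation (V G) A⊎B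
    Related  P x (inj₁ i) = x ≡ a i
    Related  P x (inj₂ j) = Related R x (b j)
    related? P x (inj₁ i) = element-≟ (V G) x (a i)
    related? P x (inj₂ j) = related? R x (b j)

    Q : Relation A⊎B (V H)
    Related  Q (inj₁ i) p = Related R (a i) p
    Related  Q (inj₂ j) p = b j ≡ p
    related? Q (inj₁ i) p = related? R (a i) p
    related? Q (inj₂ j) p = element-≟ (V H) (b j) p

    PQ⇒R : ∀ {x p} → Related (compose P Q) x p → Related R x p
    PQ⇒R (inj₁ i , refl , Rap) = Rap
    PQ⇒R (inj₂ j , Rxb , refl) = Rxb

    R⇒PQ : ∀ {x p} → Related R x p → Related (compose P Q) x p
    R⇒PQ Rxp with cover Rxp
    ... | inj₁ x∈A with i , refl ← a-surjective x∈A = inj₁ i , refl , Rxp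
    ... | inj₂ p∈B with j , refl ← b-surjective p∈B = inj₂ j , Rxp , refl

    Pdom : FullDomain P
    Pdom x = let p , Rxp = Rdom x ; k , Pxk , _ = R⇒PQ Rxp in k , Pxk

    Qimg : FullImage Q
    Qimg p = let x , Rxp = Rimg p ; k , _ , Qkp = R⇒PQ Rxp in k , Qkp

    Pimg : FullImage P
    Pimg (inj₁ i) = a i , refl
    Pimg (inj₂ j) = Rimg (b j)

    Qdom : FullDomain Q
    Qdom (inj₁ i) = Rdom (a i)
    Qdom (inj₂ j) = b j , refl

  -- Any choice of `f x` related to `x` by `R` sends edges of `G` to edges of `G ∗ R`, that is, of
  -- `H`. Injectivity is what the matching supplies.
  core-injective-hom : InjectiveHom G H
  core-injective-hom = f , f-injective , f-hom
    where
    related-to? : ∀ i j → Dec (Related R (G.from i) (H.from j))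
    related-to? i j = related? R (G.from i) (H.from j)

    r : Fin (order G) → Subset (order H)
    r i = comprehension (related-to? i)

    cover : ∀ C {x p} → Related R x p → G.to x ∈ ∁ C ⊎ H.to p ∈ neighbours r C
    cover C {x} {p} Rxp with G.to x ∈? C
    ... | no  x∉C = inj₁ (x∉p⇒x∈∁p x∉C)
    ... | yes x∈C = inj₂ (∈-neighbours⁺ r C x∈C (∈-comprehension⁺ (related-to? _)
            (subst₂ (Related R) (sym (G.strictlyInverseʳ x)) (sym (H.strictlyInverseʳ p)) Rxp)))

    hall : Hall r
    -- The cover by `∁ C` and the neighbours of `C` bounds `order G`; cancelling `∣ ∁ C ∣` leaves
    -- Hall's inequality for `C`.
    hall C = ℕ.+-cancelˡ-≤ ∣ ∁ C ∣ _ _ (begin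
      ∣ ∁ C ∣ + ∣ C ∣              ≡⟨ cong (_+ ∣ C ∣) (∣∁p∣≡n∸∣p∣ C) ⟩
      order G ∸ ∣ C ∣ + ∣ C ∣      ≡⟨ ℕ.m∸n+n≡m (∣p∣≤n C) ⟩
      order G                      ≤⟨ core≤cover (∁ C) (neighbours r C) (cover C) ⟩
      ∣ ∁ C ∣ + ∣ neighbours r C ∣ ∎)
      where open ℕ.≤-Reasoning

    φ = proj₁ (matching r hall)
    φ-injective = proj₁ (proj₂ (matching r hall))
    φ∈r = proj₂ (proj₂ (matching r hall))

    f : Element (V G) → Element (V H)
    f x = H.from (φ (G.to x))

    f-injective : Injective _≡_ _≡_ f
    f-injective eq = G.to-injective (φ-injective (H.from-injective eq))

    f∈R : ∀ x → Related R x (f x)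
    f∈R x = subst (λ u → Related R u (f x)) (G.strictlyInverseʳ x)
              (∈-comprehension⁻ (related-to? _) (φ∈r (G.to x)))

    f-hom : ∀ {x y} → Edge G x y → Edge H (f x) (f y)
    f-hom {x} {y} xy = proj₁ G∗R⇔H (x , y , xy , f∈R x , f∈R y)

-- Isomorphism from injective homomorphisms in both directions

mutual-injective-homs⇒≅ : ∀ {G H} → InjectiveHom G H → InjectiveHom H G → G ≅ H
mutual-injective-homs⇒≅ {G} {H} (f , f-injective , f-hom) (g , g-injective , g-hom) = record
  { bijection = mk↔ₛ′ f (proj₁ ∘ f-surjective) (proj₂ ∘ f-surjective)
                  (λ x → f-injective (proj₂ (f-surjective (f x))))
  ; edges     = λ x y → mk⇔ f-hom (f-reflects x y)
  }
  where
  module G = Enumeration (V G)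
  module H = Enumeration (V H)

  f-surjective : ∀ y → ∃[ x ] f x ≡ y
  -- The image of `f` contains every value of `f ∘ g`, so it is closed under that map and contains
  -- `f (g y)`; recurrence pulls membership back to `y`.
  f-surjective y = recurrent (g-injective ∘ f-injective) H.to-injective
    (λ z → ∃[ x ] f x ≡ z) (λ z _ → g z , refl) y (g y , refl)

  -- Reflecting an edge requires both endpoints to return at the same time, so recurrence is applied
  -- to pairs.
  code : Element (V G) × Element (V G) → Fin (order G * order G)
  code (x , y) = combine (G.to x) (G.to y)

  code-injective : Injective _≡_ _≡_ code
  code-injective {x , y} {x′ , y′} eq =
    let x≡ , y≡ = combine-injective (G.to x) (G.to y) (G.to x′) (G.to y′) eq in
    cong₂ _,_ (G.to-injective x≡) (G.to-injective y≡)

  σ : Element (V G) × Element (V G) → Element (V G) × Element (V G)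
  σ (x , y) = g (f x) , g (f y)

  σ-injective : Injective _≡_ _≡_ σ
  σ-injective eq = let x≡ , y≡ = ,-injective eq in
    cong₂ _,_ (f-injective (g-injective x≡)) (f-injective (g-injective y≡))

  f-reflects : ∀ x y → Edge H (f x) (f y) → Edge G x y
  -- Applying `g` turns the edge of `H` into an edge of `G` at `σ (x , y)`; edges of `G` are
  -- preserved by `σ`, so they recur at `(x , y)`.
  f-reflects x y fxfy = recurrent σ-injective code-injective
    (λ (u , v) → Edge G u v) (λ _ → g-hom ∘ f-hom) (x , y) (g-hom fxfy)

proposition3p14 : (G H : Graph) → IsRCore G → IsRCore H → G ∽w H → G ≅ H
proposition3p14 G H G-core H-core (R , S , Rdom , Sdom , (Rimg , G∗R⇔H) , (Simg , H∗S⇔G)) =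
  mutual-injective-homs⇒≅ {G} {H}
    (core-injective-hom {G} {H} G-core R S Rdom Sdom Rimg G∗R⇔H Simg H∗S⇔G)
    (core-injective-hom {H} {G} H-core S R Sdom Rdom Simg H∗S⇔G Rimg G∗R⇔H)
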